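{- Let $S\subseteq\mathbb{N}^{\mathbb{N}}$. Then $S$ is $\boldsymbol{\Delta}^0_2$ if and only if there exists $T\subseteq\mathbb{N}^{\mathbb{N}}$ such that $S=T\setminus[T_{\infty}]$.
   Context: $\mathbb{N}^{\mathbb{N}}$ is Baire space (all functions $f:\mathbb{N}\to\mathbb{N}$, with the product topology of the discrete topology), and $\boldsymbol{\Delta}^0_2$ is the boldface Borel pointclass of subsets of $\mathbb{N}^{\mathbb{N}}$ that are both $F_\sigma$ and $G_\delta$. $\mathbb{N}^{<\mathbb{N}}$ is the set of finite sequences of natural numbers (including the empty sequence). For sequences $x,y$ (finite or infinite), $x\subseteq y$ means that $x$ is an initial segment of $y$. For $X\subseteq\mathbb{N}^{<\mathbb{N}}$, $[X]\subseteq\mathbb{N}^{\mathbb{N}}$ denotes the set of infinite sequences all of whose finite initial segments are in $X$. For $T\subseteq\mathbb{N}^{\mathbb{N}}$, define $T_{\alpha}\subseteq\mathbb{N}^{<\mathbb{N}}$ for every ordinal $\alpha$ by transfinite recursion: $T_0=\mathbb{N}^{<\mathbb{N}}$; $T_{\lambda}=\bigcap_{\beta<\lambda}T_{\beta}$ for every limit ordinal $\lambda$ (that is, $\lambda$ nonzero and not a successor); and for every ordinal $\beta$, $$T_{\beta+1}=\{x\in T_{\beta} : \text{there exist } x',x''\in[T_{\beta}] \text{ such that } x\subseteq x',\ x\subseteq x'',\ x'\in T,\ \text{and } x''\notin T\}.$$ Let $\alpha(T)$ be the least ordinal $\alpha$ such that $T_{\alpha}=T_{\alpha+1}$, and let $T_{\infty}=T_{\alpha(T)}$.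 -}

module Defs where

open import Data.Fin.Base using (toℕ)
open import Data.List.Base using (List; length; lookup)
open import Data.List.Relation.Unary.All using (All)
open import Data.Nat.Base using (ℕ)
open import Data.Product.Base using (∃; ∃₂; _×_; _,_; proj₁; proj₂)
open import Induction.WellFounded using (Acc; acc; WellFounded; WfRec; module All; module Some)
open import Level using (0ℓ; suc)
open import Relation.Binary.Bundles using (StrictTotalOrder)
open import Relation.Binary.Definitions using (tri<; tri≈; tri>)
open import Relation.Binary.PropositionalEquality using (_≡_)
open import Relation.Nullary.Negation using (¬_; contradiction)
open import Relation.Unary using (Pred; _∈_; _∉_; _⊆_; _≐_; U; ∁; ⋃; ⋂)

-- Points of Baire space are compared by _≗_, so a set of points is a
-- predicate that respects _≗_.

Baire : Set
Baire = ℕ → ℕ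

Seq : Set
Seq = List ℕ

infix 4 _⊑_

_⊑_ : Seq → Baire → Set
x ⊑ f = ∀ i → lookup x i ≡ f (toℕ i)

[_] : Pred Seq 0ℓ → Pred Baire 0ℓ
[ X ] f = ∀ x → x ⊑ f → x ∈ X

------------------------------------------------------------------------
-- Topology

-- Product of discrete spaces: the basic neighbourhoods of f are given
-- by agreement with f at finitely many coordinates.

Open : Pred Baire 0ℓ → Set
Open V = ∀ f → f ∈ V →
  ∃ λ (is : List ℕ) → ∀ g → All (λ i → f i ≡ g i) is → g ∈ V

Closed : Pred Baire 0ℓ → Set
Closed C = Open (∁ C)

Fσ : Pred Baire 0ℓ → Set₁
Fσ S = ∃ λ (C : ℕ → Pred Baire 0ℓ) → (∀ n → Closed (C n)) × S ≐ ⋃ ℕ C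

Gδ : Pred Baire 0ℓ → Set₁
Gδ S = ∃ λ (V : ℕ → Pred Baire 0ℓ) → (∀ n → Open (V n)) × S ≐ ⋂ ℕ V

Δ⁰₂ : Pred Baire 0ℓ → Set₁
Δ⁰₂ S = Fσ S × Gδ S

------------------------------------------------------------------------
-- Ordinals

record WellOrder : Set₁ where
  field
    strictTotalOrder : StrictTotalOrder 0ℓ 0ℓ 0ℓ

  open StrictTotalOrder strictTotalOrder public

  field
    <-wellFounded : WellFounded _<_

  IsZero : Carrier → Set
  IsZero a = ∀ b → ¬ (b < a)

  _IsSuccOf_ : Carrier → Carrier → Set
  a IsSuccOf b = b < a × (∀ c → ¬ (b < c × c < a))

  IsLimit : Carrier → Set
  IsLimit a = ¬ IsZero a × ¬ (∃ λ b → a IsSuccOf b)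

-- An ordinal is given by a point a of a well-order, and stands for the
-- order type of { b | b < a }.  The ordinals below it are then the
-- points b < a of the same well-order.

record Ordinal : Set₁ where
  constructor _at_
  field
    wellOrder : WellOrder
    point     : WellOrder.Carrier wellOrder

------------------------------------------------------------------------
-- The transfinite sequence T_α

-- T_{β+1} as a function of X = T_β.

derive : Pred Baire 0ℓ → Pred Seq 0ℓ → Pred Seq 0ℓ
derive T X x = x ∈ X × ∃₂ λ (x′ x″ : Baire) →
  x′ ∈ [ X ] × x″ ∈ [ X ] × x ⊑ x′ × x ⊑ x″ × x′ ∈ T × x″ ∉ T

module Sequence (T : Pred Baire 0ℓ) (W : WellOrder) where
  open WellOrder W

  -- At most one of the two conjuncts is not vacuous, and at zero both
  -- are vacuous; see stage-zero, stage-suc and stage-limit.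

  clauses : ∀ a → WfRec _<_ (λ _ → Pred Seq 0ℓ) a → Pred Seq 0ℓ
  clauses a rec x =
    (∀ {b} (b<a : b < a) → a IsSuccOf b → x ∈ derive T (rec b<a)) ×
    (IsLimit a → ∀ {b} (b<a : b < a) → x ∈ rec b<a)

  stage : Carrier → Pred Seq 0ℓ
  stage = All.wfRec <-wellFounded (suc 0ℓ) (λ _ → Pred Seq 0ℓ) clauses

  private
    derive-cong : ∀ {X Y} → X ≐ Y → derive T X ⊆ derive T Y
    derive-cong (X⊆Y , _) (x∈X , x′ , x″ , p , q , r) =
      X⊆Y x∈X , x′ , x″ , (λ y s → X⊆Y (p y s)) , (λ y s → X⊆Y (q y s)) , r

    clauses-cong : ∀ a {r s : WfRec _<_ (λ _ → Pred Seq 0ℓ) a} →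
                   (∀ {b} (b<a : b < a) → r b<a ≐ s b<a) → clauses a r ⊆ clauses a s
    clauses-cong a e (p , q) =
      (λ b<a c → derive-cong (e b<a) (p b<a c)) ,
      (λ l b<a → proj₁ (e b<a) (q l b<a))

    builder : ∀ {a} → Acc _<_ a → Pred Seq 0ℓ
    builder = Some.wfRec (λ _ → Pred Seq 0ℓ) clauses _

    irrelevant : ∀ {a} (p q : Acc _<_ a) → builder p ≐ builder q
    irrelevant {a} (acc rs) (acc rs′) =
      clauses-cong a (λ b<a → irrelevant (rs b<a) (rs′ b<a)) ,
      clauses-cong a (λ b<a → irrelevant (rs′ b<a) (rs b<a))

    unfold : ∀ a → stage a ≐ clauses a (λ {b} _ → stage b)
    unfold a with <-wellFounded a
    ... | acc rs =
      clauses-cong a (λ {b} b<a → irrelevant (rs b<a) (<-wellFounded b)) ,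
      clauses-cong a (λ {b} b<a → irrelevant (<-wellFounded b) (rs b<a))

    resp-⊆ : ∀ {a b} → a ≈ b → stage a ⊆ stage b
    resp-⊆ {a} {b} a≈b x∈a with proj₁ (unfold a) x∈a
    ... | p , q = proj₂ (unfold b)
      ( (λ c<b (_ , c⋖b) → p (back c<b)
          (back c<b , λ d (c<d , d<a) → c⋖b d (c<d , <-respʳ-≈ a≈b d<a)))
      , (λ (nz , ns) c<b → q
          ( (λ z → nz (λ d d<b → z d (back d<b)))
          , (λ (d , d<a , d⋖a) → ns (d , <-respʳ-≈ a≈b d<a ,
              λ e (d<e , e<b) → d⋖a e (d<e , back e<b))))
          (back c<b)))
      where
      back : ∀ {c} → c < b → c < a
      back = <-respʳ-≈ (Eq.sym a≈b)

    stage-resp-≈ : ∀ {a b} → a ≈ b → stage a ≐ stage b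
    stage-resp-≈ a≈b = resp-⊆ a≈b , resp-⊆ (Eq.sym a≈b)

    pred-unique : ∀ {a b c} → a IsSuccOf b → a IsSuccOf c → b ≈ c
    pred-unique {a} {b} {c} (b<a , b⋖a) (c<a , c⋖a) with compare b c
    ... | tri< b<c _ _ = contradiction (b<c , c<a) (b⋖a c)
    ... | tri≈ _ b≈c _ = b≈c
    ... | tri> _ _ c<b = contradiction (c<b , b<a) (c⋖a b)

  stage-zero : ∀ {a} → IsZero a → stage a ≐ U
  stage-zero {a} z = _ , λ _ → proj₂ (unfold a)
    ((λ b<a _ → contradiction b<a (z _)) , (λ (nz , _) → contradiction z nz))

  stage-suc : ∀ {a b} → a IsSuccOf b → stage a ≐ derive T (stage b)
  stage-suc {a} {b} s@(b<a , _) =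
    (λ x∈a → proj₁ (proj₁ (unfold a) x∈a) b<a s) ,
    (λ x∈ → proj₂ (unfold a)
      ( (λ _ s′ → derive-cong (stage-resp-≈ (pred-unique s s′)) x∈)
      , (λ (_ , ns) → contradiction (b , s) ns)))

  stage-limit : ∀ {a} → IsLimit a → stage a ≐ (λ x → ∀ b → b < a → x ∈ stage b)
  stage-limit {a} l@(_ , ns) =
    (λ x∈a b b<a → proj₂ (proj₁ (unfold a) x∈a) l b<a) ,
    (λ h → proj₂ (unfold a)
      ((λ _ s → contradiction (_ , s) ns) , (λ _ b<a → h _ b<a)))

infix 30 _⟨_⟩

_⟨_⟩ : Pred Baire 0ℓ → Ordinal → Pred Seq 0ℓ
T ⟨ W at a ⟩ = Sequence.stage T W a

-- α = α(T), the least α with T_α = T_{α+1}; then T_∞ is T ⟨ α ⟩.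

IsClosureOrdinal : Pred Baire 0ℓ → Ordinal → Set
IsClosureOrdinal T (W at a) =
  stage a ≐ derive T (stage a) × (∀ b → b < a → ¬ (stage b ≐ derive T (stage b)))
  where
  open WellOrder W
  open Sequence T W

{-# OPTIONS --safe #-}

-- If x ∉ [T_α], then some b < α has x ∈ [T_b] and an initial segment s of x
-- with s ∉ T_{b+1}, so that T is constant on the closed set of points of [T_b]
-- through s.  Sorting the points outside [T_α] by these sets, which are
-- determined by s, makes both T ∖ [T_α] and its complement F_σ.
--
-- Conversely, if S is Δ⁰₂, take T = S: both S and its complement would be
-- comeagre in the closed set [S_∞], which is therefore empty.

module Submission where

open import Defs
open import Axiom.DoubleNegationElimination using (em⇒dne)
open import Axiom.ExcludedMiddle using (ExcludedMiddle)
open import Data.Fin.Base using (zero; suc)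
open import Data.List.Base using ([]; _∷_; _++_; length; applyUpTo; upTo)
open import Data.List.Extrema.Nat using (max; xs≤max)
open import Data.List.Properties using (length-applyUpTo; lookup-applyUpTo)
import Data.List.Relation.Unary.All as All
open import Data.List.Relation.Unary.All.Properties using (applyUpTo⁻; ++⁻)
open import Data.Nat.Base using (ℕ; zero; suc; _<_; _≤_; _⊔_; z≤n; s≤s; _≤′_; ≤′-refl; ≤′-step)
open import Data.Nat.Properties
  using (≤-refl; ≤-trans; <-≤-trans; m≤n⇒m≤1+n; m≤m⊔n; m≤n⊔m; ≤⇒≤′; ≤-total)
open import Data.Product.Base using (Σ; ∃; _×_; _,_; proj₁; proj₂)
open import Data.Sum.Base using (_⊎_; inj₁; inj₂)
open import Function.Base using (id; _∘_)
open import Function.Bundles using (_⇔_; mk⇔)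
open import Induction.WellFounded using (Acc; acc; WellFounded)
open import Level using (0ℓ; lift; lower) renaming (suc to lsuc)
open import Relation.Binary.Definitions using (_Respects_; Trichotomous; tri<; tri≈; tri>)
open import Relation.Binary.PropositionalEquality
  using (_≡_; _≗_; refl; sym; trans; cong; cong₂; subst)
open import Relation.Binary.Structures.Biased using (isStrictTotalOrderᶜ)
open import Relation.Nullary.Decidable.Core using (yes; no; map′)
open import Relation.Nullary.Negation using (¬_; contradiction)
open import Relation.Unary using (Pred; _∈_; _∉_; _⊆_; _≐_; _∖_; _∩_; ∁; ⋂; U)
open import Relation.Unary.Properties using (≐-refl; ≐-sym; ≐-trans)

-- Initial segments

prefix : Baire → ℕ → Seq
prefix = applyUpTo

Agree : ℕ → Baire → Baire → Set
Agree k f g = ∀ i → i < k → f i ≡ g i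

agree-sym : ∀ {k f g} → Agree k f g → Agree k g f
agree-sym f~g i i<k = sym (f~g i i<k)

agree-trans : ∀ {k f g h} → Agree k f g → Agree k g h → Agree k f h
agree-trans f~g g~h i i<k = trans (f~g i i<k) (g~h i i<k)

agree-≤ : ∀ {j k f g} → j ≤ k → Agree k f g → Agree j f g
agree-≤ j≤k f~g i i<j = f~g i (<-≤-trans i<j j≤k)

prefix-⊑ : ∀ f k → prefix f k ⊑ f
prefix-⊑ f k = lookup-applyUpTo f k

⊑⇒≡prefix : ∀ {x f} → x ⊑ f → x ≡ prefix f (length x)
⊑⇒≡prefix {[]}    x⊑f = refl
⊑⇒≡prefix {_ ∷ _} x⊑f = cong₂ _∷_ (x⊑f zero) (⊑⇒≡prefix (x⊑f ∘ suc))

agree⇒prefix-≡ : ∀ {f g} k → Agree k f g → prefix f k ≡ prefix g k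
agree⇒prefix-≡ zero    f~g = refl
agree⇒prefix-≡ (suc k) f~g = cong₂ _∷_ (f~g 0 (s≤s z≤n)) (agree⇒prefix-≡ k (λ i i<k → f~g (suc i) (s≤s i<k)))

prefix-≡⇒agree : ∀ {f g} k → prefix f k ≡ prefix g k → Agree k f g
prefix-≡⇒agree (suc k) eq zero    _         = cong (λ { [] → 0 ; (n ∷ _) → n }) eq
prefix-≡⇒agree (suc k) eq (suc i) (s≤s i<k) =
  prefix-≡⇒agree k (cong (λ { [] → [] ; (_ ∷ ns) → ns }) eq) i i<k

prefix-⊑⇒agree : ∀ {f g} k → prefix f k ⊑ g → Agree k f g
prefix-⊑⇒agree {f} {g} k p⊑g =
  prefix-≡⇒agree k (subst (λ m → prefix f k ≡ prefix g m) (length-applyUpTo f k) (⊑⇒≡prefix p⊑g))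

∈[]⇒prefix∈ : ∀ {X} f k → f ∈ [ X ] → prefix f k ∈ X
∈[]⇒prefix∈ f k f∈ = f∈ (prefix f k) (prefix-⊑ f k)

prefixes∈⇒∈[] : ∀ {X f} → (∀ k → prefix f k ∈ X) → f ∈ [ X ]
prefixes∈⇒∈[] {X} h x x⊑f = subst X (sym (⊑⇒≡prefix x⊑f)) (h (length x))

[]-limit : ∀ {X f} → (∀ k → ∃ λ g → Agree k f g × g ∈ [ X ]) → f ∈ [ X ]
[]-limit {X} h = prefixes∈⇒∈[] λ k → let g , f~g , g∈ = h k in
  subst X (sym (agree⇒prefix-≡ k f~g)) (∈[]⇒prefix∈ g k g∈)

-- Topology of Baire space

open-ball : ∀ {V} → Open V → ∀ f → f ∈ V → ∃ λ k → ∀ g → Agree k f g → g ∈ V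
open-ball V-open f f∈V = let is , nbhd = V-open f f∈V in
  -- One more than the largest listed coordinate; 0 covers the empty list.
  suc (max 0 is) , λ g f~g → nbhd g (All.map (λ i≤ → f~g _ (s≤s i≤)) (xs≤max 0 is))

ball-open : ∀ {V} → (∀ f → f ∈ V → ∃ λ k → ∀ g → Agree k f g → g ∈ V) → Open V
ball-open h f f∈V = let k , nbhd = h f f∈V in
  upTo k , λ g f~g → nbhd g λ i → applyUpTo⁻ id k f~g

∩-open : ∀ {V W} → Open V → Open W → Open (V ∩ W)
∩-open V-open W-open f (f∈V , f∈W) =
  let is , v = V-open f f∈V
      js , w = W-open f f∈W
  in is ++ js , λ g f~g → let p , q = ++⁻ is f~g in v g p , w g q

-- Baire category in the closed set `[ X ]`: each ball is recentred at a point of `V n` and shrunk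
-- into `V n`, and the centres converge.
baire-category : ∀ {X} {V : ℕ → Pred Baire 0ℓ} → (∀ n → Open (V n)) →
  (∀ n k p → p ∈ [ X ] → ∃ λ q → q ∈ [ X ] × q ∈ V n × Agree k p q) →
  ∃ [ X ] → ∃ λ f → f ∈ [ X ] × (∀ n → f ∈ V n)
baire-category {X} {V} V-open dense (p₀ , p₀∈) = limit , limit∈ , limit∈V
  where
  Ball : Set
  Ball = Σ Baire λ p → p ∈ [ X ] × ℕ

  ball : ℕ → Ball
  ball zero    = p₀ , p₀∈ , 0
  ball (suc n) = let p , p∈ , k = ball n
                     q , q∈ , q∈V , _ = dense n k p p∈
                 -- The successor makes the radii grow strictly, so that the centres converge.
                 in q , q∈ , suc (k ⊔ proj₁ (open-ball (V-open n) q q∈V))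

  centre : ℕ → Baire
  centre n = proj₁ (ball n)

  radius : ℕ → ℕ
  radius n = proj₂ (proj₂ (ball n))

  centre∈ : ∀ n → centre n ∈ [ X ]
  centre∈ n = proj₁ (proj₂ (ball n))

  ball⊆V : ∀ n {g} → Agree (radius (suc n)) (centre (suc n)) g → g ∈ V n
  ball⊆V n {g} q~g =
    let p , p∈ , k = ball n
        q , q∈ , q∈V , _ = dense n k p p∈
    in proj₂ (open-ball (V-open n) q q∈V) g (agree-≤ (m≤n⇒m≤1+n (m≤n⊔m k _)) q~g)

  centre-step : ∀ n → Agree (radius n) (centre n) (centre (suc n))
  centre-step n = let p , p∈ , k = ball n in proj₂ (proj₂ (proj₂ (dense n k p p∈)))

  radius-step : ∀ n → radius n < radius (suc n)
  radius-step n = s≤s (m≤m⊔n (radius n) _)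

  n≤radius : ∀ n → n ≤ radius n
  n≤radius zero    = z≤n
  n≤radius (suc n) = ≤-trans (s≤s (n≤radius n)) (radius-step n)

  radius-mono : ∀ {m n} → m ≤′ n → radius m ≤ radius n
  radius-mono ≤′-refl           = ≤-refl
  radius-mono (≤′-step {n} m≤n) =
    ≤-trans (radius-mono m≤n) (≤-trans (m≤n⇒m≤1+n ≤-refl) (radius-step n))

  centre-agree : ∀ {m n} → m ≤′ n → Agree (radius m) (centre m) (centre n)
  centre-agree ≤′-refl           = λ _ _ → refl
  centre-agree (≤′-step {n} m≤n) =
    agree-trans (centre-agree m≤n) (agree-≤ (radius-mono m≤n) (centre-step n))

  limit : Baire
  -- Coordinate `i` is final from `centre (suc i)` on, whose radius exceeds `i`.
  limit i = centre (suc i) i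

  centre-limit : ∀ n → Agree (radius n) (centre n) limit
  centre-limit n i i<r with ≤-total n (suc i)
  ... | inj₁ n≤ = centre-agree (≤⇒≤′ n≤) i i<r
  ... | inj₂ i< = sym (centre-agree (≤⇒≤′ i<) i (n≤radius (suc i)))

  limit∈ : limit ∈ [ X ]
  limit∈ = []-limit λ k → centre k , agree-≤ (n≤radius k) (agree-sym (centre-limit k)) , centre∈ k

  limit∈V : ∀ n → limit ∈ V n
  limit∈V n = ball⊆V n (centre-limit (suc n))

derive-mono : ∀ {T X Y} → X ⊆ Y → derive T X ⊆ derive T Y
derive-mono X⊆Y (x∈X , x′ , x″ , p , q , r) =
  X⊆Y x∈X , x′ , x″ , (λ y s → X⊆Y (p y s)) , (λ y s → X⊆Y (q y s)) , r

module Classical (em : ExcludedMiddle 0ℓ) where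

  dne : {P : Set} → ¬ ¬ P → P
  dne = em⇒dne em

  ¬∀⇒∃¬ : {A : Set} {P : Pred A 0ℓ} → ¬ (∀ a → P a) → ∃ λ a → ¬ P a
  ¬∀⇒∃¬ ¬all = dne λ ¬ex → ¬all λ a → dne λ ¬p → ¬ex (a , ¬p)

  limit-closed : ∀ {C} → (∀ f → (∀ k → ∃ λ g → Agree k f g × g ∈ C) → f ∈ C) → Closed C
  limit-closed h = ball-open λ f f∉C →
    let k , ¬∃g = ¬∀⇒∃¬ (λ close → f∉C (h f close)) in
    k , λ g f~g g∈C → ¬∃g (g , f~g , g∈C)

  -- Points of `S` and points outside `S` are both dense in `[ X ]`, so category yields a point in
  -- every `V n` and in no `C n`.
  [X]-empty : ∀ {S X} → Δ⁰₂ S → X ⊆ derive S X → ∀ f → f ∉ [ X ]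
  [X]-empty {S} {X} ((C , C-closed , S⊆⋃C , ⋃C⊆S) , (V , V-open , S⊆⋂V , ⋂V⊆S)) X⊆ f f∈ =
    let g , _ , g∈ = baire-category (λ n → ∩-open (V-open n) (C-closed n)) dense (f , f∈)
        m , g∈Cm   = S⊆⋃C (⋂V⊆S (λ n → proj₁ (g∈ n)))
    in proj₂ (g∈ m) g∈Cm
    where
    dense : ∀ n k p → p ∈ [ X ] →
            ∃ λ q → q ∈ [ X ] × q ∈ (V n ∩ ∁ (C n)) × Agree k p q
    dense n k p p∈ =
      let _ , y , _ , y∈ , _ , p⊑y , _ , y∈S , _ = X⊆ (∈[]⇒prefix∈ p k p∈)
          j , ball⊆V = open-ball (V-open n) y (S⊆⋂V y∈S n)
          -- Agreement with `y` up to `k` keeps `z` near `p`, and up to `j` keeps it in `V n`.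
          _ , _ , z , _ , z∈ , _ , y⊑z , _ , z∉S = X⊆ (∈[]⇒prefix∈ y (k ⊔ j) y∈)
          y~z = prefix-⊑⇒agree (k ⊔ j) y⊑z
      in z , z∈
       , (ball⊆V z (agree-≤ (m≤n⊔m k j) y~z) , λ z∈C → z∉S (⋃C⊆S (n , z∈C)))
       , agree-trans (prefix-⊑⇒agree k p⊑y) (agree-≤ (m≤m⊔n k j) y~z)

  -- Stages along a well-order.

  module Stages (T : Pred Baire 0ℓ) (W : WellOrder) where
    open WellOrder W renaming (_<_ to _≺_; trans to ≺-trans)
    open Sequence T W

    -- Induction on `a`: below a limit some stage lies strictly between, and below a successor `b`
    -- is at most the predecessor.
    stage⊆derive-acc : ∀ {a b} → Acc _≺_ a → b ≺ a → stage a ⊆ derive T (stage b)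
    stage⊆derive-acc {a} {b} (acc rs) b≺a x∈ with em {IsZero a} | em {∃ λ c → a IsSuccOf c}
    ... | yes z  | _ = contradiction b≺a (z b)
    ... | no nz  | no ns with em {∃ λ c → b ≺ c × c ≺ a}
    ...   | yes (c , b≺c , c≺a) =
      stage⊆derive-acc (rs c≺a) b≺c (proj₁ (stage-limit (nz , ns)) x∈ c c≺a)
    ...   | no ¬between = contradiction (b , b≺a , λ c between → ¬between (c , between)) ns
    stage⊆derive-acc {a} {b} (acc rs) b≺a x∈ | no _ | yes (c , s@(c≺a , gap)) with compare b c
    ...   | tri< b≺c _ _ = stage⊆derive-acc (rs c≺a) b≺c (proj₁ (proj₁ (stage-suc s) x∈))
    ...   | tri≈ _ b≈c _ =
      proj₁ (stage-suc (b≺a , λ d (b≺d , d≺a) → gap d (<-respˡ-≈ b≈c b≺d , d≺a))) x∈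
    ...   | tri> _ _ c≺b = contradiction (c≺b , b≺a) (gap b)

    stage⊆derive : ∀ {a b} → b ≺ a → stage a ⊆ derive T (stage b)
    stage⊆derive = stage⊆derive-acc (<-wellFounded _)

    -- With `stage⊆derive`, this merges the three clauses into one: `T_a` is the intersection of the
    -- derivatives of all earlier stages.
    ⋂derive⊆stage : ∀ a {x} → (∀ b → b ≺ a → x ∈ derive T (stage b)) → x ∈ stage a
    ⋂derive⊆stage a h with em {IsZero a} | em {∃ λ c → a IsSuccOf c}
    ... | yes z | _              = proj₂ (stage-zero z) _
    ... | no _  | yes (c , s)    = proj₂ (stage-suc s) (h c (proj₁ s))
    ... | no nz | no ns          = proj₂ (stage-limit (nz , ns)) λ b b≺a → proj₁ (h b b≺a)

    stage-antitone : ∀ {a b} → ¬ (a ≺ b) → stage a ⊆ stage b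
    stage-antitone {a} {b} a⊀b x∈ = ⋂derive⊆stage b λ c c≺b → stage⊆derive (c≺a c≺b) x∈
      where
      c≺a : ∀ {c} → c ≺ b → c ≺ a
      c≺a {c} c≺b with compare a b
      ... | tri< a≺b _ _ = contradiction a≺b a⊀b
      ... | tri≈ _ a≈b _ = <-respʳ-≈ (Eq.sym a≈b) c≺b
      ... | tri> _ _ b≺a = ≺-trans c≺b b≺a

    ∉stage⇒∉derive : ∀ {a x} → x ∉ stage a → ∃ λ b → b ≺ a × x ∉ derive T (stage b)
    ∉stage⇒∉derive {a} x∉ = dne λ ¬ex →
      x∉ (⋂derive⊆stage a λ b b≺a → dne λ x∉′ → ¬ex (b , b≺a , x∉′))

    -- Well-founded descent: if `x` is already missing from `stage b`, the search goes on below `b`.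
    seq-rank : ∀ {a x} → Acc _≺_ a → x ∉ stage a →
               ∃ λ b → b ≺ a × x ∈ stage b × x ∉ derive T (stage b)
    seq-rank {a} {x} (acc rs) x∉ with ∉stage⇒∉derive x∉
    ... | b , b≺a , x∉′ with em {x ∈ stage b}
    ...   | yes x∈b = b , b≺a , x∈b , x∉′
    ...   | no x∉b  = let c , c≺b , p = seq-rank (rs b≺a) x∉b in c , ≺-trans c≺b b≺a , p

    point-rank : ∀ {a f} → Acc _≺_ a → f ∉ [ stage a ] →
                 ∃ λ b → b ≺ a × f ∈ [ stage b ] × ∃ λ k → prefix f k ∉ derive T (stage b)
    point-rank {a} {f} (acc rs) f∉ with ¬∀⇒∃¬ (λ h → f∉ (prefixes∈⇒∈[] h))
    ... | k , x∉ with ∉stage⇒∉derive x∉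
    ...   | b , b≺a , x∉′ with em {f ∈ [ stage b ]}
    ...     | yes f∈b = b , b≺a , f∈b , k , x∉′
    ...     | no f∉b  = let c , c≺b , p = point-rank (rs b≺a) f∉b in c , ≺-trans c≺b b≺a , p

    -- Closed pieces covering the complement of `[T_a]`.

    module _ (a : Carrier) where

      -- With s the initial segment of f of length k and s ∈ T_b ∖ T_{b+1},
      -- the second component says f ∈ [T_b].
      Piece : ℕ → Pred Baire 0ℓ
      Piece k f = prefix f k ∉ stage a ×
                  (∀ b → b ≺ a → prefix f k ∈ stage b → f ∈ [ stage b ])

      piece-∉ : ∀ {k f} → f ∈ Piece k → f ∉ [ stage a ]
      piece-∉ {k} {f} (x∉ , _) f∈ = x∉ (∈[]⇒prefix∈ f k f∈)

      piece-cover : ∀ {f} → f ∉ [ stage a ] → ∃ λ k → f ∈ Piece k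
      piece-cover {f} f∉ =
        let b , b≺a , f∈b , k , x∉ = point-rank (<-wellFounded a) f∉ in
        k , (λ x∈a → x∉ (stage⊆derive b≺a x∈a)) ,
        -- The segment is lost right after stage `b`, so a stage `c` that still contains it is not
        -- later than `b`.
        λ c _ x∈c y y⊑f → stage-antitone (λ b≺c → x∉ (stage⊆derive b≺c x∈c)) (f∈b y y⊑f)

      -- Both points lie in `[T_b]`, where `b` is the stage right after which their common segment
      -- is lost; if `T` separated them, they would keep it in `T_{b+1}`.
      piece-constant : ∀ {k f g} → Agree k f g → f ∈ Piece k → g ∈ Piece k → f ∈ T → g ∈ T
      piece-constant {k} {f} {g} f~g (x∉ , f-in) (_ , g-in) f∈T = dne λ g∉T →
        let b , b≺a , x∈b , x∉′ = seq-rank (<-wellFounded a) x∉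
            eq = agree⇒prefix-≡ k f~g
        in x∉′ ( x∈b , f , g , f-in b b≺a x∈b , g-in b b≺a (subst (stage b) eq x∈b)
               , prefix-⊑ f k , subst (_⊑ g) (sym eq) (prefix-⊑ g k) , f∈T , g∉T )

      piece-limit : ∀ {k f} → (∀ j → ∃ λ g → Agree j f g × g ∈ Piece k) → f ∈ Piece k
      piece-limit {k} {f} h =
        (λ x∈ → let g , f~g , x∉ , _ = h k in x∉ (subst (stage a) (agree⇒prefix-≡ k f~g) x∈)) ,
        λ b b≺a x∈b → []-limit λ j →
          let g , f~g , _ , g-in = h (k ⊔ j) in
          g , agree-≤ (m≤n⊔m k j) f~g ,
          g-in b b≺a (subst (stage b) (agree⇒prefix-≡ k (agree-≤ (m≤m⊔n k j) f~g)) x∈b)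

      -- A limit shares its first `k` values with a point of the set, which decides `Q` there. This
      -- serves both `T` and its complement.
      piece-∩-closed : ∀ {Q} k →
        (∀ {f g} → Agree k f g → f ∈ Piece k → g ∈ Piece k → f ∈ Q → g ∈ Q) →
        Closed (Piece k ∩ Q)
      piece-∩-closed k constant = limit-closed λ f h →
        let f∈ = piece-limit λ j → let g , f~g , g∈ , _ = h j in g , f~g , g∈
            g , f~g , g∈ , g∈Q = h k
        in f∈ , constant (agree-sym f~g) g∈ f∈ g∈Q

      ∖-Δ⁰₂ : Δ⁰₂ (T ∖ [ stage a ])
      ∖-Δ⁰₂ =
        ( (λ k → Piece k ∩ T) , (λ k → piece-∩-closed k piece-constant)
        , (λ (f∈T , f∉) → let k , f∈ = piece-cover f∉ in k , f∈ , f∈T)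
        , (λ (k , f∈ , f∈T) → f∈T , piece-∉ f∈) ) ,
        -- The complement of the difference is the union of `[T_a]` and the closed sets
        -- `Piece k ∩ ∁ T`.
        ( (λ k → ∁ (Piece k ∩ ∁ T) ∩ ∁ [ stage a ])
        , (λ k → ∩-open
            (piece-∩-closed k λ f~g f∈ g∈ f∉T g∈T →
              f∉T (piece-constant (agree-sym f~g) g∈ f∈ g∈T))
            (limit-closed λ f → []-limit))
        , (λ (f∈T , f∉) k → (λ (_ , f∉T) → f∉T f∈T) , f∉)
        -- Index 0 is arbitrary: every open set of the family misses `[T_a]`.
        , (λ h → let k , f∈ = piece-cover (proj₂ (h 0)) in
            dne (λ f∉T → proj₁ (h k) (f∈ , f∉T)) , proj₂ (h 0)) )

  -- Existence of the closure ordinal.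

  -- Only countably many stages differ, since each one loses a sequence; so
  -- terms with countable branching name all of them, and the order on the
  -- names can be read off from the stages themselves.
  module ClosureOrdinal (T : Pred Baire 0ℓ) where

    data Code : Set where
      top : Code
      inf : (Seq → Code) → Code

    -- `top` names zero, and `inf c` the supremum of the successors of the ordinals named by the
    -- `c s`.
    ⟦_⟧ : Code → Pred Seq 0ℓ
    ⟦ top ⟧   = U
    ⟦ inf c ⟧ = ⋂ Seq λ s → derive T ⟦ c s ⟧

    -- The recursive call swaps the arguments: once `⟦ c ⟧` fails to lie in the derivative of
    -- `⟦ d s ⟧`, only `⟦ d s ⟧ ⊆ ⟦ c ⟧` remains, and the derivative is monotone.
    comparable : ∀ c d → ⟦ c ⟧ ⊆ ⟦ d ⟧ ⊎ ⟦ d ⟧ ⊆ derive T ⟦ c ⟧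
    comparable c top     = inj₁ _
    comparable c (inf d) with em {∀ s → ⟦ c ⟧ ⊆ derive T ⟦ d s ⟧}
    ... | yes c⊆ = inj₁ λ x∈ s → c⊆ s x∈
    ... | no c⊈ with ¬∀⇒∃¬ c⊈
    ...   | s , c⊈ds with comparable (d s) c
    ...     | inj₁ ds⊆c = inj₂ λ x∈ → derive-mono ds⊆c (x∈ s)
    ...     | inj₂ c⊆ds = contradiction (λ {x} → c⊆ds {x}) c⊈ds

    infix 4 _≺_ _≈_

    -- Stages shrink, so non-inclusion means that `c` comes strictly earlier; all codes from `α(T)`
    -- on are identified.
    _≺_ _≈_ : Code → Code → Set
    c ≺ d = ¬ (⟦ c ⟧ ⊆ ⟦ d ⟧)
    c ≈ d = ⟦ c ⟧ ≐ ⟦ d ⟧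

    ≺⇒⊆derive : ∀ {c d} → c ≺ d → ⟦ d ⟧ ⊆ derive T ⟦ c ⟧
    ≺⇒⊆derive {c} {d} c≺d with comparable c d
    ... | inj₁ c⊆d = contradiction (λ {x} → c⊆d {x}) c≺d
    ... | inj₂ d⊆  = d⊆

    ≺-trans : ∀ {c d e} → c ≺ d → d ≺ e → c ≺ e
    ≺-trans {c} {d} c≺d d≺e c⊆e = d≺e λ x∈ → c⊆e (proj₁ (≺⇒⊆derive {c} {d} c≺d x∈))

    ≺-compare : Trichotomous _≈_ _≺_
    ≺-compare c d with em {⟦ c ⟧ ⊆ ⟦ d ⟧} | em {⟦ d ⟧ ⊆ ⟦ c ⟧}
    ... | yes c⊆d | yes d⊆c = tri≈ (λ c≺d → c≺d c⊆d) (c⊆d , d⊆c) (λ d≺c → d≺c d⊆c)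
    ... | yes c⊆d | no d≺c  = tri> (λ c≺d → c≺d c⊆d) (λ (_ , d⊆c) → d≺c d⊆c) d≺c
    ... | no c≺d  | yes d⊆c = tri< c≺d (λ (c⊆d , _) → c≺d c⊆d) (λ d≺c → d≺c d⊆c)
    ... | no c≺d  | no d≺c  = contradiction (λ {x} x∈ → proj₁ (≺⇒⊆derive {c} {d} c≺d {x} x∈)) d≺c

    ≺-acc-⊆ : ∀ {c d} → ⟦ d ⟧ ⊆ ⟦ c ⟧ → Acc _≺_ d → Acc _≺_ c
    ≺-acc-⊆ d⊆c (acc rs) = acc λ e≺c → rs λ e⊆d → e≺c λ x∈ → d⊆c (e⊆d x∈)

    -- A code before `inf d` is no later than some `d s`, so structural induction suffices.
    ≺-wellFounded : WellFounded _≺_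
    ≺-wellFounded top     = acc λ c≺top → contradiction _ c≺top
    ≺-wellFounded (inf d) = acc below
      where
      below : ∀ {c} → c ≺ inf d → Acc _≺_ c
      below {c} c≺ with ¬∀⇒∃¬ {P = λ s → ⟦ c ⟧ ⊆ derive T ⟦ d s ⟧} (λ h → c≺ λ x∈ s → h s x∈)
      ... | s , c⊈ds with comparable (d s) c
      ...   | inj₁ ds⊆c = ≺-acc-⊆ ds⊆c (≺-wellFounded (d s))
      ...   | inj₂ c⊆ds = contradiction (λ {x} → c⊆ds {x}) c⊈ds

    codes : WellOrder
    codes = record
      { strictTotalOrder = record
        { isStrictTotalOrder = isStrictTotalOrderᶜ record
          { isEquivalence = record
            { refl  = ≐-refl
            ; sym   = ≐-sym
            ; trans = ≐-trans
            }
          ; trans   = λ {c} {d} {e} → ≺-trans {c} {d} {e}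
          ; compare = ≺-compare
          }
        }
      ; <-wellFounded = ≺-wellFounded
      }

    ⋂derive⊆⟦⟧ : ∀ c {x} → (∀ b → b ≺ c → x ∈ derive T ⟦ b ⟧) → x ∈ ⟦ c ⟧
    ⋂derive⊆⟦⟧ top     h   = _
    ⋂derive⊆⟦⟧ (inf d) h s with em {⟦ d s ⟧ ⊆ ⟦ inf d ⟧}
    ... | no ds≺  = h (d s) ds≺
    -- Here the sequence is already stationary at `d s`, and the induction hypothesis for `d s`
    -- applies.
    ... | yes ds⊆ = ds⊆ (⋂derive⊆⟦⟧ (d s) λ b b≺ds →
                      h b λ b⊆ → b≺ds λ x∈ → proj₁ (b⊆ x∈ s)) s

    open Sequence T codes
    open Stages T codes using (stage⊆derive; ⋂derive⊆stage)

    -- Both sides are the intersection of the derivatives of their predecessors.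
    stage≐⟦⟧ : ∀ c → Acc _≺_ c → stage c ≐ ⟦ c ⟧
    stage≐⟦⟧ c (acc rs) =
      (λ {x} x∈ → ⋂derive⊆⟦⟧ c λ b b≺c →
        derive-mono {X = stage b} {⟦ b ⟧} (proj₁ (stage≐⟦⟧ b (rs b≺c)))
          (stage⊆derive {c} {b} b≺c x∈)) ,
      (λ {x} x∈ → ⋂derive⊆stage c λ b b≺c →
        derive-mono {X = ⟦ b ⟧} {stage b} (proj₂ (stage≐⟦⟧ b (rs b≺c)))
          (≺⇒⊆derive {b} {c} b≺c x∈))

    -- Gives minimality of `∞`: a stage fixed before `∞` would be contained in `⟦ ∞ ⟧`.
    fixpoint⊆ : ∀ {X} → X ⊆ derive T X → ∀ c → X ⊆ ⟦ c ⟧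
    fixpoint⊆ X⊆ top     _     = _
    fixpoint⊆ X⊆ (inf c) x∈X s = derive-mono (fixpoint⊆ X⊆ (c s)) (X⊆ x∈X)

    remover : Seq → Code
    remover s with em {∃ λ c → s ∉ derive T ⟦ c ⟧}
    ... | yes (c , _) = c
    -- For a sequence that is never removed any code would do.
    ... | no _        = top

    remover-∉ : ∀ {s} c → s ∉ derive T ⟦ c ⟧ → s ∉ derive T ⟦ remover s ⟧
    remover-∉ {s} c s∉ with em {∃ λ c → s ∉ derive T ⟦ c ⟧}
    ... | yes (_ , s∉′) = s∉′
    ... | no ¬ex        = contradiction (c , s∉) ¬ex

    ∞ : Code
    ∞ = inf remover

    ⟦∞⟧⊆derive : ∀ c → ⟦ ∞ ⟧ ⊆ derive T ⟦ c ⟧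
    -- Each `s` is tested at its own index, against a code that removes it if any does.
    ⟦∞⟧⊆derive c {s} s∈ = dne λ s∉ → remover-∉ c s∉ (s∈ s)

    stage∞⊆derive : stage ∞ ⊆ derive T (stage ∞)
    stage∞⊆derive x∈ = let e = stage≐⟦⟧ ∞ (≺-wellFounded ∞) in
      derive-mono {X = ⟦ ∞ ⟧} {stage ∞} (proj₂ e) (⟦∞⟧⊆derive ∞ (proj₁ e x∈))

    ∞-closure : IsClosureOrdinal T (codes at ∞)
    ∞-closure = (stage∞⊆derive , proj₁) , λ b b≺∞ (b⊆ , _) →
      b≺∞ λ x∈ → fixpoint⊆ {stage b} b⊆ ∞ (proj₂ (stage≐⟦⟧ b (≺-wellFounded b)) x∈)

  -- The equivalence.

  Represented : Pred Baire 0ℓ → Set₁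
  Represented S = ∃ λ (T : Pred Baire 0ℓ) → T Respects _≗_ ×
    ∃ λ (α : Ordinal) → IsClosureOrdinal T α × S ≐ T ∖ [ T ⟨ α ⟩ ]

  Δ⁰₂⇒represented : ∀ {S} → S Respects _≗_ → Δ⁰₂ S → Represented S
  Δ⁰₂⇒represented {S} S-resp S-Δ =
    S , S-resp , (codes at ∞) , ∞-closure ,
    (λ {f} f∈S → f∈S , [X]-empty {S} {S ⟨ codes at ∞ ⟩} S-Δ stage∞⊆derive f) , proj₁
    where open ClosureOrdinal S

  represented⇒Δ⁰₂ : ∀ {S} → Represented S → Δ⁰₂ S
  represented⇒Δ⁰₂ (T , _ , (W at a) , _ , S≐) =
    let (C , C-closed , C≐) , (V , V-open , V≐) = Stages.∖-Δ⁰₂ T W a in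
    (C , C-closed , ≐-trans S≐ C≐) , (V , V-open , ≐-trans S≐ V≐)

theorem10 :
    ExcludedMiddle (lsuc 0ℓ) →
    (S : Pred Baire 0ℓ) → S Respects _≗_ →
    Δ⁰₂ S ⇔
      (∃ λ (T : Pred Baire 0ℓ) → T Respects _≗_ ×
        ∃ λ (α : Ordinal) → IsClosureOrdinal T α × S ≐ T ∖ [ T ⟨ α ⟩ ])
theorem10 em S S-resp = mk⇔ (Δ⁰₂⇒represented S-resp) represented⇒Δ⁰₂
  where open Classical (map′ lower lift em)
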